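{- Fix an integer $r\geq 3$, and let $c_{r,2}=4^r-3^r+2^r$ and $d_{r,2}=3^r+1$. Then: (i) The order of $f_{r,2}(x):=1+x+x^{2^r}+x^{2^r+2}\in\mathbb{F}_2[x]$ divides $4^r+2^r+1$. (ii) The polynomial $h_{r,2}(x):=(1+x^{4^r+2^r+1})/f_{r,2}(x)\in\mathbb{F}_2[x]$ satisfies $\ell_1(h_{r,2}(x))=c_{r,2}$. (iii) Hence $\beta_{4^r+2^r+1}(f_{r,2}(x))=(c_{r,2},d_{r,2})$, and $f_{r,2}(x)$ is robust.
   Context: For $f\in\mathbb{F}_2[x]$ with $f(0)=1$ and $\deg f\ge 1$, the order $\operatorname{ord}(f)$ is the least integer $D\ge 1$ such that $f(x)\mid 1+x^D$ in $\mathbb{F}_2[x]$. For $g\in\mathbb{F}_2[x]$, $\ell_1(g)$ is the number of monomials of $g$ (terms with coefficient $1$), and for $N\ge\deg g$, $\ell_{0,N}(g)$ is the number of exponents $k\in\{0,1,\dots,N\}$ for which the coefficient of $x^k$ in $g$ is $0$. If $N$ is a positive multiple of $\operatorname{ord}(f)$ and $g(x)=(1+x^N)/f(x)$, then $\beta_N(f)=(\ell_1(g),\ell_{0,N-1}(g))$. With $D=\operatorname{ord}(f)$ and $f^*(x)=(1+x^D)/f(x)$, the polynomial $f$ is called robust if $\ell_1(f^*)>\ell_{0,D-1}(f^*)+1$, equivalently $\ell_1(f^*)>(D+1)/2$. -}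

module Defs where

open import Algebra.Bundles.Raw using (RawMagma)
import Algebra.Definitions.RawMagma as RawMagmaDefinitions
open import Data.List.Base using (List; []; _∷_; _++_; filter; length; map; replicate; upTo)
open import Data.List.Extrema.Nat using (max)
open import Data.Nat.Base using (ℕ; zero; suc; _+_; _∸_; _^_; _≤_; _<_; _>_)
open import Data.Nat.Divisibility using () renaming (_∣_ to _∣ℕ_)
open import Data.Parity.Base as ℙ using (Parity; 0ℙ; 1ℙ)
open import Data.Parity.Properties using (_≟_)
open import Data.Product.Base using (_×_; _,_; ∃₂)
open import Level using (0ℓ)
open import Relation.Binary.PropositionalEquality.Core using (_≡_)

infixl 6 _⊕_
infixl 7 _⊗_
infix  4 _≈_
infix  8 x^_

-- 𝔽₂[x], with Parity as the field 𝔽₂: coefficient lists, constant term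
-- first.  Trailing zeros are allowed, so equality of polynomials is _≈_.

Poly : Set
Poly = List Parity

coeff : Poly → ℕ → Parity
coeff []      _       = 0ℙ
coeff (a ∷ _) zero    = a
coeff (_ ∷ p) (suc k) = coeff p k

_≈_ : Poly → Poly → Set
p ≈ q = ∀ k → coeff p k ≡ coeff q k

_⊕_ : Poly → Poly → Poly
[]      ⊕ q       = q
(a ∷ p) ⊕ []      = a ∷ p
(a ∷ p) ⊕ (b ∷ q) = (a ℙ.+ b) ∷ (p ⊕ q)

-- (a + x p) q = a q + x (p q)
_⊗_ : Poly → Poly → Poly
[]      ⊗ q = []
(a ∷ p) ⊗ q = map (a ℙ.*_) q ⊕ (0ℙ ∷ p ⊗ q)

x^_ : ℕ → Poly
x^ n = replicate n 0ℙ ++ (1ℙ ∷ [])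

⊗-rawMagma : RawMagma 0ℓ 0ℓ
⊗-rawMagma = record { Carrier = Poly ; _≈_ = _≈_ ; _∙_ = _⊗_ }

open RawMagmaDefinitions ⊗-rawMagma public using (_∣_)

-- Largest exponent with nonzero coefficient; the zero polynomial gets 0.
deg : Poly → ℕ
deg p = max 0 (filter (λ k → coeff p k ≟ 1ℙ) (upTo (length p)))

ℓ₁ : Poly → ℕ
ℓ₁ g = length (filter (_≟ 1ℙ) g)

-- ℓ₀ N g is ℓ_{0,N}(g); the exponents k range over 0, …, N inclusive.
ℓ₀ : ℕ → Poly → ℕ
ℓ₀ N g = length (filter (λ k → coeff g k ≟ 0ℙ) (upTo (suc N)))

-- "D = ord(f)", as a relation: being the least such D, it is unique.
record IsOrder (f : Poly) (D : ℕ) : Set where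
  field
    constant : coeff f 0 ≡ 1ℙ
    deg≥1    : 1 ≤ deg f
    D≥1      : 1 ≤ D
    divides  : f ∣ x^ 0 ⊕ x^ D
    least    : ∀ E → 1 ≤ E → f ∣ x^ 0 ⊕ x^ E → D ≤ E

-- "g = p / f", as a relation: for f ≉ 0 the quotient is unique up to _≈_,
-- and ℓ₁ and ℓ₀ are invariant under _≈_.
IsQuotient : Poly → Poly → Poly → Set
IsQuotient g p f = g ⊗ f ≈ p

-- "β_N(f) = v".  Here deg g < N, so ℓ₀ (N ∸ 1) g lies in the intended range.
IsBeta : ℕ → Poly → ℕ × ℕ → Set
IsBeta N f v = ∃₂ λ D g →
  IsOrder f D × 0 < N × D ∣ℕ N ×
  IsQuotient g (x^ 0 ⊕ x^ N) f × (ℓ₁ g , ℓ₀ (N ∸ 1) g) ≡ v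

Robust : Poly → Set
Robust f = ∃₂ λ D f* →
  IsOrder f D × IsQuotient f* (x^ 0 ⊕ x^ D) f × ℓ₁ f* > ℓ₀ (D ∸ 1) f* + 1

f₂ : ℕ → Poly
f₂ r = x^ 0 ⊕ x^ 1 ⊕ x^ (2 ^ r) ⊕ x^ (2 ^ r + 2)

N₂ : ℕ → ℕ
N₂ r = 4 ^ r + 2 ^ r + 1

-- This is (4 ^ r ∸ 3 ^ r) + 2 ^ r, in which nothing is truncated.
c₂ : ℕ → ℕ
c₂ r = 4 ^ r ∸ 3 ^ r + 2 ^ r

d₂ : ℕ → ℕ
d₂ r = 3 ^ r + 1

module Submission where

-- Put q = 2^r, y = x^q and N = q² + q + 1.  Then f = (1 + x) (1 + z) with z = y (1 + x),
-- and 1 + z times the sum of z^k over k < q - 1 is 1 + z^(q-1).  By Frobenius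
-- z^q = x^(q²) (1 + y), whence
--   h = (1 + x + … + x^(q²-1)) + y (1 + z + … + z^(q-2))
-- satisfies h f = 1 + x^N.  The polynomials y^k (1 + x)^k, k < q, occupy disjoint blocks
-- of q exponents, so the second summand has as many terms as rows 0, …, q - 2 of Pascal's
-- triangle modulo 2 have ones: 3^r - 2^r.  Hence h has 4^r - (3^r - 2^r) terms.
--
-- Let u be the power series 1 / f.  Then f divides 1 + x^E exactly when u has period E,
-- so ord(f) is the least period D of u, and D divides N.  With k = N / D, the counts of
-- ones and zeros of h are k times those of f*; this forces robustness.

open import Defs
open import Data.List.Base using ([]; _∷_; applyUpTo; filter; length; map; upTo)
open import Data.List.Extrema.Nat using (xs≤max)
open import Data.List.Membership.Propositional.Properties using (∈-filter⁺; ∈-upTo⁺)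
open import Data.List.Properties using (length-applyUpTo)
import Data.List.Relation.Unary.All as All
open import Data.Maybe.Base using (just; nothing)
open import Data.Nat.Base
  using (ℕ; zero; suc; pred; _+_; _*_; _∸_; _^_; _≤_; _<_; z≤n; s≤s; z<s; s<s; NonZero; >-nonZero)
open import Data.Nat.DivMod using (_/_; _%_; m≡m%n+[m/n]*n; m%n<n; m<n⇒m%n≡m; [m+n]%n≡m%n)
open import Data.Nat.Divisibility using (∣⇒≤; m∣m*n; divides) renaming (_∣_ to _∣ℕ_)
open import Data.Nat.GCD using (gcd; gcd-greatest)
open import Data.Nat.Induction using (<-rec)
import Data.Nat.Properties as ℕ
open import Data.Nat.Tactic.RingSolver using () renaming (solve-∀ to solveℕ-∀)
open import Data.Parity.Base as ℙ using (Parity; 0ℙ; 1ℙ)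
import Data.Parity.Properties as ℙ
open import Data.Product.Base using (_×_; _,_; ∃-syntax)
open import Function.Base using (_∘_; const; case_of_)
open import Level using (0ℓ)
open import Relation.Binary.PropositionalEquality
  using (_≡_; _≗_; refl; sym; trans; cong; cong₂; subst; module ≡-Reasoning)
open import Relation.Nullary using (¬_; yes; no; contradiction)
open import Relation.Nullary.Decidable using (map′)
open import Relation.Unary using (Decidable)
open import Tactic.RingSolver using (solve-∀)
open import Tactic.RingSolver.Core.AlmostCommutativeRing
  using (AlmostCommutativeRing; fromCommutativeRing)

-- A test recognising 0 lets the solver use 1 + 1 = 0.
𝔽₂ : AlmostCommutativeRing 0ℓ 0ℓ
𝔽₂ = fromCommutativeRing ℙ.+-*-commutativeRing λ { 0ℙ → just refl ; 1ℙ → nothing }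

+-telescope : ∀ a b c → (a ℙ.+ b) ℙ.+ (b ℙ.+ c) ≡ a ℙ.+ c
+-telescope = solve-∀ 𝔽₂

+-interchange : ∀ a b c d → (a ℙ.+ b) ℙ.+ (c ℙ.+ d) ≡ (a ℙ.+ c) ℙ.+ (b ℙ.+ d)
+-interchange = solve-∀ 𝔽₂

-- Power series over 𝔽₂

Seq : Set
Seq = ℕ → Parity

infixl 6 _⊞_

_⊞_ : Seq → Seq → Seq
(a ⊞ b) n = a n ℙ.+ b n

δ : Seq
δ zero    = 1ℙ
δ (suc _) = 0ℙ

shift : ℕ → Seq → Seq
shift zero    a         = a
shift (suc k) a zero    = 0ℙ
shift (suc k) a (suc n) = shift k a n

Vanishes : ℕ → Seq → Set
Vanishes m a = ∀ {n} → m ≤ n → a n ≡ 0ℙ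

⊞-cong : ∀ {a b c d} → a ≗ b → c ≗ d → a ⊞ c ≗ b ⊞ d
⊞-cong e e′ n = cong₂ ℙ._+_ (e n) (e′ n)

shift-cong : ∀ k {a b} → a ≗ b → shift k a ≗ shift k b
shift-cong zero    e         = e
shift-cong (suc k) e zero    = refl
shift-cong (suc k) e (suc n) = shift-cong k e n

shift-⊞ : ∀ k a b → shift k (a ⊞ b) ≗ shift k a ⊞ shift k b
shift-⊞ zero    a b n       = refl
shift-⊞ (suc k) a b zero    = refl
shift-⊞ (suc k) a b (suc n) = shift-⊞ k a b n

shift-shift : ∀ j k a → shift j (shift k a) ≗ shift (j + k) a
shift-shift zero    k a n       = refl
shift-shift (suc j) k a zero    = refl
shift-shift (suc j) k a (suc n) = shift-shift j k a n

shift-comm : ∀ j k a → shift j (shift k a) ≗ shift k (shift j a)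
shift-comm j k a n = begin
  shift j (shift k a) n  ≡⟨ shift-shift j k a n ⟩
  shift (j + k) a n      ≡⟨ cong (λ i → shift i a n) (ℕ.+-comm j k) ⟩
  shift (k + j) a n      ≡⟨ shift-shift k j a n ⟨
  shift k (shift j a) n  ∎
  where open ≡-Reasoning

shift-+ : ∀ k a n → shift k a (k + n) ≡ a n
shift-+ zero    a n = refl
shift-+ (suc k) a n = shift-+ k a n

shift-< : ∀ {k n} a → n < k → shift k a n ≡ 0ℙ
shift-< {suc k} {zero}  a _       = refl
shift-< {suc k} {suc n} a (s<s l) = shift-< a l

shift-vanishes : ∀ k {m a} → Vanishes m a → Vanishes (k + m) (shift k a)
shift-vanishes zero    v l       = v l
shift-vanishes (suc k) v (s≤s l) = shift-vanishes k v l

shift-local-≤ : ∀ k {a b : Seq} n → (∀ {m} → m ≤ n → a m ≡ b m) → shift k a n ≡ shift k b n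
shift-local-≤ zero    n       e = e ℕ.≤-refl
shift-local-≤ (suc k) zero    e = refl
shift-local-≤ (suc k) (suc n) e = shift-local-≤ k n (e ∘ ℕ.m≤n⇒m≤1+n)

-- A positive shift reads only strictly earlier entries, so strong induction on the index can solve
-- equations between series.
shift-local : ∀ k .{{_ : NonZero k}} {a b : Seq} n →
              (∀ {m} → m < n → a m ≡ b m) → shift k a n ≡ shift k b n
shift-local (suc k) zero    e = refl
shift-local (suc k) (suc n) e = shift-local-≤ k n (e ∘ s≤s)

≗-<-rec : ∀ {a b : Seq} → (∀ n → (∀ {m} → m < n → a m ≡ b m) → a n ≡ b n) → a ≗ b
≗-<-rec step = <-rec _ step

-- Products of polynomials

coeff-⊕ : ∀ p q → coeff (p ⊕ q) ≗ coeff p ⊞ coeff q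
coeff-⊕ []      q       n       = refl
coeff-⊕ (a ∷ p) []      n       = sym (ℙ.+-identityʳ _)
coeff-⊕ (a ∷ p) (b ∷ q) zero    = refl
coeff-⊕ (a ∷ p) (b ∷ q) (suc n) = coeff-⊕ p q n

coeff-map-* : ∀ a p n → coeff (map (a ℙ.*_) p) n ≡ a ℙ.* coeff p n
coeff-map-* a []      n       = sym (ℙ.*-zeroʳ a)
coeff-map-* a (b ∷ p) zero    = refl
coeff-map-* a (b ∷ p) (suc n) = coeff-map-* a p n

coeff-0∷ : ∀ p → coeff (0ℙ ∷ p) ≗ shift 1 (coeff p)
coeff-0∷ p zero    = refl
coeff-0∷ p (suc n) = refl

coeff-x^ : ∀ k → coeff (x^ k) ≗ shift k δ
coeff-x^ zero    zero    = refl
coeff-x^ zero    (suc n) = refl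
coeff-x^ (suc k) zero    = refl
coeff-x^ (suc k) (suc n) = coeff-x^ k n

coeff-∷-⊗ : ∀ a p q → coeff ((a ∷ p) ⊗ q) ≗ (λ n → a ℙ.* coeff q n) ⊞ shift 1 (coeff (p ⊗ q))
coeff-∷-⊗ a p q n = trans (coeff-⊕ (map (a ℙ.*_) q) (0ℙ ∷ p ⊗ q) n)
  (cong₂ ℙ._+_ (coeff-map-* a q n) (coeff-0∷ (p ⊗ q) n))

-- `⊗` recurses on its left factor, but `f₂ r` is the right factor in `IsQuotient`. With
-- `coeff-⊗-x^`, this expands that factor into shifts.
⊗-distribˡ-⊕ : ∀ g p q → coeff (g ⊗ (p ⊕ q)) ≗ coeff (g ⊗ p) ⊞ coeff (g ⊗ q)
⊗-distribˡ-⊕ []      p q n = refl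
⊗-distribˡ-⊕ (a ∷ g) p q n = begin
  coeff ((a ∷ g) ⊗ (p ⊕ q)) n
    ≡⟨ coeff-∷-⊗ a g (p ⊕ q) n ⟩
  a ℙ.* coeff (p ⊕ q) n ℙ.+ shift 1 (coeff (g ⊗ (p ⊕ q))) n
    ≡⟨ cong₂ ℙ._+_ (cong (a ℙ.*_) (coeff-⊕ p q n))
         (trans (shift-cong 1 (⊗-distribˡ-⊕ g p q) n) (shift-⊞ 1 (coeff (g ⊗ p)) (coeff (g ⊗ q)) n)) ⟩
  a ℙ.* (coeff p n ℙ.+ coeff q n) ℙ.+ (shift 1 (coeff (g ⊗ p)) n ℙ.+ shift 1 (coeff (g ⊗ q)) n)
    ≡⟨ rearrange a (coeff p n) (coeff q n) (shift 1 (coeff (g ⊗ p)) n) (shift 1 (coeff (g ⊗ q)) n) ⟩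
  (a ℙ.* coeff p n ℙ.+ shift 1 (coeff (g ⊗ p)) n) ℙ.+ (a ℙ.* coeff q n ℙ.+ shift 1 (coeff (g ⊗ q)) n)
    ≡⟨ cong₂ ℙ._+_ (coeff-∷-⊗ a g p n) (coeff-∷-⊗ a g q n) ⟨
  coeff ((a ∷ g) ⊗ p) n ℙ.+ coeff ((a ∷ g) ⊗ q) n ∎
  where
  open ≡-Reasoning
  rearrange : ∀ a b c d e → a ℙ.* (b ℙ.+ c) ℙ.+ (d ℙ.+ e) ≡ (a ℙ.* b ℙ.+ d) ℙ.+ (a ℙ.* c ℙ.+ e)
  rearrange = solve-∀ 𝔽₂

coeff-⊗-0∷ : ∀ g p → coeff (g ⊗ (0ℙ ∷ p)) ≗ shift 1 (coeff (g ⊗ p))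
coeff-⊗-0∷ []      p zero    = refl
coeff-⊗-0∷ []      p (suc n) = refl
coeff-⊗-0∷ (a ∷ g) p zero    = trans (ℙ.+-identityʳ _) (ℙ.*-zeroʳ a)
coeff-⊗-0∷ (a ∷ g) p (suc n) = begin
  coeff (map (a ℙ.*_) p ⊕ g ⊗ (0ℙ ∷ p)) n
    ≡⟨ coeff-⊕ (map (a ℙ.*_) p) (g ⊗ (0ℙ ∷ p)) n ⟩
  coeff (map (a ℙ.*_) p) n ℙ.+ coeff (g ⊗ (0ℙ ∷ p)) n
    ≡⟨ cong₂ ℙ._+_ (coeff-map-* a p n) (coeff-⊗-0∷ g p n) ⟩
  a ℙ.* coeff p n ℙ.+ shift 1 (coeff (g ⊗ p)) n
    ≡⟨ coeff-∷-⊗ a g p n ⟨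
  coeff ((a ∷ g) ⊗ p) n ∎
  where open ≡-Reasoning

coeff-⊗-x^ : ∀ g k → coeff (g ⊗ x^ k) ≗ shift k (coeff g)
coeff-⊗-x^ []      zero    n       = refl
coeff-⊗-x^ (a ∷ g) zero    zero    = trans (ℙ.+-identityʳ _) (ℙ.*-identityʳ a)
coeff-⊗-x^ (a ∷ g) zero    (suc n) = coeff-⊗-x^ g zero n
coeff-⊗-x^ g       (suc k) zero    = coeff-⊗-0∷ g (x^ k) zero
coeff-⊗-x^ g       (suc k) (suc n) = trans (coeff-⊗-0∷ g (x^ k) (suc n)) (coeff-⊗-x^ g k n)

coeff-applyUpTo-< : ∀ a {m n} → n < m → coeff (applyUpTo a m) n ≡ a n
coeff-applyUpTo-< a {suc m} {zero}  _       = refl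
coeff-applyUpTo-< a {suc m} {suc n} (s<s l) = coeff-applyUpTo-< (a ∘ suc) l

coeff-≥ : ∀ p {n} → length p ≤ n → coeff p n ≡ 0ℙ
coeff-≥ []      _       = refl
coeff-≥ (a ∷ p) (s≤s l) = coeff-≥ p l

coeff≡1⇒< : ∀ p {n} → coeff p n ≡ 1ℙ → n < length p
coeff≡1⇒< p {n} e = ℕ.≰⇒> λ l → case trans (sym e) (coeff-≥ p l) of λ ()

coeff≡1⇒≤deg : ∀ p {n} → coeff p n ≡ 1ℙ → n ≤ deg p
coeff≡1⇒≤deg p {n} e = All.lookup (xs≤max 0 (filter (λ k → coeff p k ℙ.≟ 1ℙ) (upTo (length p))))
  (∈-filter⁺ (λ k → coeff p k ℙ.≟ 1ℙ) (∈-upTo⁺ (coeff≡1⇒< p e)) e)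

-- Counting ones

# : ℕ → Seq → ℕ
# m a = ℓ₁ (applyUpTo a m)

applyUpTo-cong-< : ∀ m {a b : Seq} → (∀ {i} → i < m → a i ≡ b i) → applyUpTo a m ≡ applyUpTo b m
applyUpTo-cong-< zero    e = refl
applyUpTo-cong-< (suc m) e = cong₂ _∷_ (e z<s) (applyUpTo-cong-< m (e ∘ s<s))

#-cong : ∀ m {a b} → (∀ {i} → i < m → a i ≡ b i) → # m a ≡ # m b
#-cong m e = cong ℓ₁ (applyUpTo-cong-< m e)

#-+ : ∀ m n a → # (m + n) a ≡ # m a + # n (a ∘ (m +_))
#-+ zero    n a = refl
#-+ (suc m) n a with a 0
... | 0ℙ = #-+ m n (a ∘ suc)
... | 1ℙ = cong suc (#-+ m n (a ∘ suc))

#-0 : ∀ m → # m (const 0ℙ) ≡ 0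
#-0 zero    = refl
#-0 (suc m) = #-0 m

#-complement : ∀ m a → # m (const 1ℙ ⊞ a) + # m a ≡ m
#-complement zero    a = refl
#-complement (suc m) a with a 0
... | 0ℙ = cong suc (#-complement m (a ∘ suc))
... | 1ℙ = trans (ℕ.+-suc _ _) (cong suc (#-complement m (a ∘ suc)))

-- The supports are disjoint, so no ones cancel.
#-⊞-shift : ∀ m n {a} b → Vanishes m a → # (m + n) (a ⊞ shift m b) ≡ # m a + # n b
#-⊞-shift m n {a} b v = trans (#-+ m n (a ⊞ shift m b)) (cong₂ _+_
  (#-cong m λ {i} l → trans (cong (a i ℙ.+_) (shift-< b l)) (ℙ.+-identityʳ (a i)))
  (#-cong n λ {i} _ → cong₂ ℙ._+_ (v (ℕ.m≤m+n m i)) (shift-+ m b i)))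

#-widen : ∀ m n {a} → Vanishes m a → # (m + n) a ≡ # m a
#-widen m n {a} v = trans (#-+ m n a) (trans
  (cong (# m a +_) (trans (#-cong n λ {i} _ → v (ℕ.m≤m+n m i)) (#-0 n)))
  (ℕ.+-identityʳ (# m a)))

-- Stated for a general index map `f`, because unfolding `upTo` replaces `f` by `f ∘ suc`.
length-zeros : ∀ m (f : ℕ → ℕ) a →
               # m (a ∘ f) + length (filter (λ k → a k ℙ.≟ 0ℙ) (applyUpTo f m)) ≡ m
length-zeros zero    f a = refl
length-zeros (suc m) f a with a (f 0)
... | 1ℙ = cong suc (length-zeros m (f ∘ suc) a)
... | 0ℙ = trans (ℕ.+-suc _ _) (cong suc (length-zeros m (f ∘ suc) a))

-- `ℓ₀` includes its upper endpoint, so the bound `m ∸ 1` covers `m` exponents, provided that `m` is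
-- not 0.
ℓ₁+ℓ₀ : ∀ a m .{{_ : NonZero m}} → # m a + ℓ₀ (m ∸ 1) (applyUpTo a m) ≡ m
ℓ₁+ℓ₀ a m@(suc _) = trans
  (cong (_+ ℓ₀ (m ∸ 1) (applyUpTo a m)) (#-cong m λ l → sym (coeff-applyUpTo-< a l)))
  (length-zeros m (λ k → k) (coeff (applyUpTo a m)))

-- Rows of Pascal's triangle modulo 2: pascal k is (1 + x)^k.

-- Multiplication by `1 + x`.
Δ : Seq → Seq
Δ a = a ⊞ shift 1 a

pascal : ℕ → Seq
pascal zero    = δ
pascal (suc k) = Δ (pascal k)

pascal-vanishes : ∀ k → Vanishes (suc k) (pascal k)
pascal-vanishes zero    (s≤s _) = refl
pascal-vanishes (suc k) (s≤s l) = cong₂ ℙ._+_ (pascal-vanishes k (ℕ.m≤n⇒m≤1+n l)) (pascal-vanishes k l)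

-- Frobenius: `(1 + x)^(2^r) = 1 + x^(2^r)`. The extra factor `(1 + x)^k` lets the induction
-- hypothesis be used twice in the doubling step, where the two middle terms cancel.
pascal-frobenius : ∀ r k → pascal (k + 2 ^ r) ≗ pascal k ⊞ shift (2 ^ r) (pascal k)
pascal-frobenius zero    k n rewrite ℕ.+-comm k 1 = refl
pascal-frobenius (suc r) k n = begin
  pascal (k + (q + (q + 0))) n
    ≡⟨ cong (λ i → pascal i n) (index k q) ⟩
  pascal (k + q + q) n
    ≡⟨ pascal-frobenius r (k + q) n ⟩
  pascal (k + q) n ℙ.+ shift q (pascal (k + q)) n
    ≡⟨ cong₂ ℙ._+_ (pascal-frobenius r k n) (trans (shift-cong q (pascal-frobenius r k) n)
         (trans (shift-⊞ q (pascal k) _ n) (cong (shift q (pascal k) n ℙ.+_) (shift-shift q q (pascal k) n)))) ⟩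
  (pascal k n ℙ.+ shift q (pascal k) n) ℙ.+ (shift q (pascal k) n ℙ.+ shift (q + q) (pascal k) n)
    ≡⟨ +-telescope (pascal k n) (shift q (pascal k) n) _ ⟩
  pascal k n ℙ.+ shift (q + q) (pascal k) n
    ≡⟨ cong (λ i → pascal k n ℙ.+ shift (q + i) (pascal k) n) (ℕ.+-identityʳ q) ⟨
  pascal k n ℙ.+ shift (q + (q + 0)) (pascal k) n ∎
  where
  open ≡-Reasoning
  q = 2 ^ r
  index : ∀ k q → k + (q + (q + 0)) ≡ k + q + q
  index = solveℕ-∀

-- For `k ≤ m` the window of `m` columns cuts nothing off the rows.
pascalOnes : ℕ → ℕ → ℕ
pascalOnes m zero    = 0
pascalOnes m (suc k) = pascalOnes m k + # m (pascal k)

pascalOnes-widen : ∀ m n k → k ≤ m → pascalOnes (m + n) k ≡ pascalOnes m k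
pascalOnes-widen m n zero    _ = refl
pascalOnes-widen m n (suc k) l = cong₂ _+_ (pascalOnes-widen m n k (ℕ.<⇒≤ l))
  (#-widen m n λ l′ → pascal-vanishes k (ℕ.≤-trans l l′))

#-pascal-frobenius : ∀ r k → k < 2 ^ r →
                     # (2 ^ r + 2 ^ r) (pascal (k + 2 ^ r)) ≡ # (2 ^ r) (pascal k) + # (2 ^ r) (pascal k)
#-pascal-frobenius r k l = trans
  (#-cong (2 ^ r + 2 ^ r) λ {i} _ → pascal-frobenius r k i)
  (#-⊞-shift (2 ^ r) (2 ^ r) (pascal k) λ l′ → pascal-vanishes k (ℕ.≤-trans l l′))

-- Self-similarity of the triangle: each row `2^r + i` with `i < 2^r` consists of two disjoint
-- copies of row `i`.
pascalOnes-double : ∀ r k → k ≤ 2 ^ r → pascalOnes (2 ^ r + 2 ^ r) (k + 2 ^ r) ≡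
                    pascalOnes (2 ^ r) (2 ^ r) + (pascalOnes (2 ^ r) k + pascalOnes (2 ^ r) k)
pascalOnes-double r zero    l = trans (pascalOnes-widen (2 ^ r) (2 ^ r) (2 ^ r) ℕ.≤-refl)
  (sym (ℕ.+-identityʳ _))
pascalOnes-double r (suc k) l = trans
  (cong₂ _+_ (pascalOnes-double r k (ℕ.<⇒≤ l)) (#-pascal-frobenius r k l))
  (rearrange (pascalOnes (2 ^ r) (2 ^ r)) (pascalOnes (2 ^ r) k) (# (2 ^ r) (pascal k)))
  where
  rearrange : ∀ a b c → a + (b + b) + (c + c) ≡ a + (b + c + (b + c))
  rearrange = solveℕ-∀

pascalOnes≡3^r : ∀ r → pascalOnes (2 ^ r) (2 ^ r) ≡ 3 ^ r
pascalOnes≡3^r zero    = refl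
pascalOnes≡3^r (suc r) = begin
  pascalOnes (q + (q + 0)) (q + (q + 0))  ≡⟨ cong (λ i → pascalOnes (q + i) (q + i)) (ℕ.+-identityʳ q) ⟩
  pascalOnes (q + q) (q + q)              ≡⟨ pascalOnes-double r q ℕ.≤-refl ⟩
  pascalOnes q q + (pascalOnes q q + pascalOnes q q)
    ≡⟨ cong (λ i → i + (i + i)) (pascalOnes≡3^r r) ⟩
  3 ^ r + (3 ^ r + 3 ^ r)                 ≡⟨ cong (λ i → 3 ^ r + (3 ^ r + i)) (ℕ.+-identityʳ (3 ^ r)) ⟨
  3 * 3 ^ r                               ∎
  where
  open ≡-Reasoning
  q = 2 ^ r

-- Row `2^r - 1` is all ones: the last row of the doubled triangle is two adjacent copies of the
-- last row of the smaller one.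
#-lastRow : ∀ r → # (2 ^ r) (pascal (pred (2 ^ r))) ≡ 2 ^ r
#-lastRow zero    = refl
#-lastRow (suc r) = begin
  # (q + (q + 0)) (pascal (pred (q + (q + 0))))
    ≡⟨ cong (λ i → # (q + i) (pascal (pred (q + i)))) (ℕ.+-identityʳ q) ⟩
  # (q + q) (pascal (pred (q + q)))
    ≡⟨ cong (λ i → # (q + q) (pascal (pred (i + q)))) (ℕ.suc-pred q) ⟨
  # (q + q) (pascal (pred q + q))
    ≡⟨ #-pascal-frobenius r (pred q) (ℕ.≤-reflexive (ℕ.suc-pred q)) ⟩
  # q (pascal (pred q)) + # q (pascal (pred q))
    ≡⟨ cong₂ _+_ (#-lastRow r) (#-lastRow r) ⟩
  q + q
    ≡⟨ cong (q +_) (ℕ.+-identityʳ q) ⟨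
  q + (q + 0) ∎
  where
  open ≡-Reasoning
  q = 2 ^ r
  instance _ = ℕ.m^n≢0 2 r

-- Removes the all-ones last row, since the second summand of `h` uses only rows 0 to `q - 2`.
pascalOnes-pred : ∀ r → pascalOnes (2 ^ r) (pred (2 ^ r)) + 2 ^ r ≡ 3 ^ r
pascalOnes-pred r = begin
  pascalOnes q (pred q) + q                        ≡⟨ cong (pascalOnes q (pred q) +_) (#-lastRow r) ⟨
  pascalOnes q (suc (pred q))                      ≡⟨ cong (pascalOnes q) (ℕ.suc-pred q) ⟩
  pascalOnes q q                                   ≡⟨ pascalOnes≡3^r r ⟩
  3 ^ r                                            ∎
  where
  open ≡-Reasoning
  q = 2 ^ r
  instance _ = ℕ.m^n≢0 2 r

-- The factorisation f = (1 + x) (1 + x^q (1 + x)), with q = 2^r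

Δ-⊞ : ∀ a b → Δ (a ⊞ b) ≗ Δ a ⊞ Δ b
Δ-⊞ a b n = trans (cong (a n ℙ.+ b n ℙ.+_) (shift-⊞ 1 a b n)) (+-interchange (a n) (b n) _ _)

Δ-shift : ∀ k a → Δ (shift k a) ≗ shift k (Δ a)
Δ-shift k a n = trans (cong (shift k a n ℙ.+_) (shift-comm 1 k a n)) (sym (shift-⊞ k a (shift 1 a) n))

Δ-Δ : ∀ a → Δ (Δ a) ≗ a ⊞ shift 2 a
Δ-Δ a n = trans
  (cong (a n ℙ.+ shift 1 a n ℙ.+_) (trans (shift-⊞ 1 a (shift 1 a) n) (cong (shift 1 a n ℙ.+_) (shift-shift 1 1 a n))))
  (+-telescope (a n) (shift 1 a n) _)

-- Multiplication by `1 + z`. The next definition, `mulF`, is multiplication by `f`, in the expanded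
-- form that `coeff-⊗-f₂` produces.
mulT : ℕ → Seq → Seq
mulT q a = a ⊞ shift q (Δ a)

mulF : ℕ → Seq → Seq
mulF q a = a ⊞ shift 1 a ⊞ shift q a ⊞ shift (q + 2) a

coeff-⊗-f₂ : ∀ r g → coeff (g ⊗ f₂ r) ≗ mulF (2 ^ r) (coeff g)
coeff-⊗-f₂ r g n = trans (⊗-distribˡ-⊕ g (x^ 0 ⊕ x^ 1 ⊕ x^ q) (x^ (q + 2)) n)
  (cong₂ ℙ._+_ (trans (⊗-distribˡ-⊕ g (x^ 0 ⊕ x^ 1) (x^ q) n)
    (cong₂ ℙ._+_ (trans (⊗-distribˡ-⊕ g (x^ 0) (x^ 1) n)
      (cong₂ ℙ._+_ (coeff-⊗-x^ g 0 n) (coeff-⊗-x^ g 1 n)))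
    (coeff-⊗-x^ g q n)))
  (coeff-⊗-x^ g (q + 2) n))
  where q = 2 ^ r

mulF-cong : ∀ q {a b} → a ≗ b → mulF q a ≗ mulF q b
mulF-cong q e = ⊞-cong (⊞-cong (⊞-cong e (shift-cong 1 e)) (shift-cong q e)) (shift-cong (q + 2) e)

mulF-⊞ : ∀ q a b → mulF q (a ⊞ b) ≗ mulF q a ⊞ mulF q b
mulF-⊞ q a b n
  rewrite shift-⊞ 1 a b n | shift-⊞ q a b n | shift-⊞ (q + 2) a b n
  = interchange (a n) (b n) (shift 1 a n) (shift 1 b n) (shift q a n) (shift q b n) _ _
  where
  interchange : ∀ a b c d e f g h →
    (a ℙ.+ b) ℙ.+ (c ℙ.+ d) ℙ.+ (e ℙ.+ f) ℙ.+ (g ℙ.+ h) ≡ (a ℙ.+ c ℙ.+ e ℙ.+ g) ℙ.+ (b ℙ.+ d ℙ.+ f ℙ.+ h)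
  interchange = solve-∀ 𝔽₂

mulF-shift : ∀ q k a → mulF q (shift k a) ≗ shift k (mulF q a)
mulF-shift q k a n
  rewrite shift-⊞ k (a ⊞ shift 1 a ⊞ shift q a) (shift (q + 2) a) n
        | shift-⊞ k (a ⊞ shift 1 a) (shift q a) n
        | shift-⊞ k a (shift 1 a) n
        | shift-comm 1 k a n | shift-comm q k a n | shift-comm (q + 2) k a n
  = refl

-- `f` has constant term 1 and, as `q > 0`, its other terms only bring in earlier coefficients;
-- these agree by induction and can be cancelled.
mulF-injective : ∀ q .{{_ : NonZero q}} {a b} → mulF q a ≗ mulF q b → a ≗ b
mulF-injective q@(suc _) {a} {b} e = ≗-<-rec λ n ih → ℙ.+-cancelʳ-≡ (shift 1 b n) (a n) (b n)
  (ℙ.+-cancelʳ-≡ (shift q b n) _ _ (ℙ.+-cancelʳ-≡ (shift (q + 2) b n) _ _ (trans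
    (cong₂ ℙ._+_ (cong₂ ℙ._+_ (cong (a n ℙ.+_) (sym (shift-local 1 n ih))) (sym (shift-local q n ih)))
      (sym (shift-local (q + 2) n ih)))
    (e n))))

-- Uses `x^q + x^(q+2) = x^q (1 + x)^2`. This order of the factors suits the series `1 / (1 + x)`,
-- which `Δ` sends to 1; the reverse order below suits `geometric`, which `mulT` telescopes.
mulF≗mulT∘Δ : ∀ q a → mulF q a ≗ mulT q (Δ a)
mulF≗mulT∘Δ q a n = begin
  Δ a n ℙ.+ shift q a n ℙ.+ shift (q + 2) a n
    ≡⟨ ℙ.+-assoc (Δ a n) (shift q a n) _ ⟩
  Δ a n ℙ.+ (shift q a n ℙ.+ shift (q + 2) a n)
    ≡⟨ cong (λ i → Δ a n ℙ.+ (shift q a n ℙ.+ i)) (shift-shift q 2 a n) ⟨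
  Δ a n ℙ.+ (shift q a n ℙ.+ shift q (shift 2 a) n)
    ≡⟨ cong (Δ a n ℙ.+_) (shift-⊞ q a (shift 2 a) n) ⟨
  Δ a n ℙ.+ shift q (a ⊞ shift 2 a) n
    ≡⟨ cong (Δ a n ℙ.+_) (shift-cong q (Δ-Δ a) n) ⟨
  Δ a n ℙ.+ shift q (Δ (Δ a)) n ∎
  where open ≡-Reasoning

mulF≗Δ∘mulT : ∀ q a → mulF q a ≗ Δ (mulT q a)
mulF≗Δ∘mulT q a n = trans (mulF≗mulT∘Δ q a n)
  (sym (trans (Δ-⊞ a (shift q (Δ a)) n) (cong (Δ a n ℙ.+_) (Δ-shift q (Δ a) n))))

mulT-⊞ : ∀ q a b → mulT q (a ⊞ b) ≗ mulT q a ⊞ mulT q b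
mulT-⊞ q a b n = trans
  (cong (a n ℙ.+ b n ℙ.+_) (trans (shift-cong q (Δ-⊞ a b) n) (shift-⊞ q (Δ a) (Δ b) n)))
  (+-interchange (a n) (b n) _ _)

-- The sum of (x^q (1 + x))^i over i < k, which mulT telescopes.
geometric : ℕ → ℕ → Seq
geometric q zero    = const 0ℙ
geometric q (suc k) = geometric q k ⊞ shift (k * q) (pascal k)

shift-0 : ∀ k → shift k (const 0ℙ) ≗ const 0ℙ
shift-0 zero    n       = refl
shift-0 (suc k) zero    = refl
shift-0 (suc k) (suc n) = shift-0 k n

-- The new summand `z^k` contributes `z^k + z^(k+1)`, and its first half cancels the previous top
-- term.
mulT-geometric : ∀ q k → mulT q (geometric q k) ≗ δ ⊞ shift (k * q) (pascal k)
mulT-geometric q zero    n = trans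
  (trans (shift-cong q (shift-0 1) n) (shift-0 q n))
  (sym (ℙ.p+p≡0ℙ (δ n)))
mulT-geometric q (suc k) n = begin
  mulT q (geometric q k ⊞ s) n
    ≡⟨ mulT-⊞ q (geometric q k) s n ⟩
  mulT q (geometric q k) n ℙ.+ (s n ℙ.+ shift q (Δ s) n)
    ≡⟨ cong₂ (λ i j → i ℙ.+ (s n ℙ.+ j)) (mulT-geometric q k n)
         (trans (shift-cong q (Δ-shift (k * q) (pascal k)) n) (shift-shift q (k * q) (pascal (suc k)) n)) ⟩
  (δ n ℙ.+ s n) ℙ.+ (s n ℙ.+ shift (q + k * q) (pascal (suc k)) n)
    ≡⟨ +-telescope (δ n) (s n) _ ⟩
  δ n ℙ.+ shift (q + k * q) (pascal (suc k)) n ∎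
  where
  open ≡-Reasoning
  s = shift (k * q) (pascal k)

-- For `i < q` the summand `z^i` has exponents from `i q` to `i q + i`, so it ends before the block
-- of `z^(i+1)` starts. The count of ones below is additive for this reason.
geometric-vanishes : ∀ q k → k ≤ q → Vanishes (k * q) (geometric q k)
geometric-vanishes q zero    l l′ = refl
geometric-vanishes q (suc k) l {n} l′ = cong₂ ℙ._+_
  (geometric-vanishes q k (ℕ.<⇒≤ l) (ℕ.≤-trans (ℕ.m≤n+m (k * q) q) l′))
  (shift-vanishes (k * q) (λ i → pascal-vanishes k (ℕ.≤-trans l i))
    (subst (_≤ n) (ℕ.+-comm q (k * q)) l′))

#-geometric : ∀ q k → k ≤ q → # (k * q) (geometric q k) ≡ pascalOnes q k
#-geometric q zero    l = refl
#-geometric q (suc k) l = begin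
  # (q + k * q) (geometric q (suc k))           ≡⟨ cong (λ i → # i (geometric q (suc k))) (ℕ.+-comm q (k * q)) ⟩
  # (k * q + q) (geometric q (suc k))           ≡⟨ #-⊞-shift (k * q) q (pascal k) (geometric-vanishes q k (ℕ.<⇒≤ l)) ⟩
  # (k * q) (geometric q k) + # q (pascal k)    ≡⟨ cong (_+ # q (pascal k)) (#-geometric q k (ℕ.<⇒≤ l)) ⟩
  pascalOnes q k + # q (pascal k)               ∎
  where open ≡-Reasoning

-- The first two summands form (1 + x^(q²)) / (1 + x).
hSeq : ℕ → Seq
hSeq q = const 1ℙ ⊞ shift (q * q) (const 1ℙ) ⊞ shift q (geometric q (pred q))

Δ-1 : Δ (const 1ℙ) ≗ δ
Δ-1 zero    = refl
Δ-1 (suc n) = refl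

-- As `const 1ℙ` is `1 / (1 + x)`, only the factor `1 + z` of `f` survives.
mulF-1 : ∀ q → mulF q (const 1ℙ) ≗ δ ⊞ shift q (Δ δ)
mulF-1 q n = trans (mulF≗mulT∘Δ q (const 1ℙ) n)
  (cong₂ ℙ._+_ (Δ-1 n) (shift-cong q (⊞-cong Δ-1 (shift-cong 1 Δ-1)) n))

-- The three summands of `h` contribute `1 + z`, `x^(q²) (1 + z)` and `z (1 + z^(q-1)) = z + z^q`.
-- By the Frobenius hypothesis `z^q = x^(q²) (1 + x^q)`, and everything but `1 + x^(q²+q+1)`
-- cancels.
mulF-hSeq : ∀ q .{{_ : NonZero q}} → pascal q ≗ δ ⊞ shift q δ →
            mulF q (hSeq q) ≗ δ ⊞ shift (q * q + q + 1) δ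
mulF-hSeq q@(suc p) frobenius n = begin
  mulF q (hSeq q) n
    ≡⟨ mulF-⊞ q (const 1ℙ ⊞ shift (q * q) (const 1ℙ)) (shift q g) n ⟩
  mulF q (const 1ℙ ⊞ shift (q * q) (const 1ℙ)) n ℙ.+ mulF q (shift q g) n
    ≡⟨ cong (ℙ._+ mulF q (shift q g) n) (mulF-⊞ q (const 1ℙ) (shift (q * q) (const 1ℙ)) n) ⟩
  mulF q (const 1ℙ) n ℙ.+ mulF q (shift (q * q) (const 1ℙ)) n ℙ.+ mulF q (shift q g) n
    ≡⟨ cong₂ ℙ._+_ (cong₂ ℙ._+_ (mulF-1 q n) second) third ⟩
  (δ n ℙ.+ shift q (Δ δ) n)
    ℙ.+ (shift (q * q) δ n ℙ.+ (shift (q * q + q) δ n ℙ.+ shift (q * q + q + 1) δ n))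
    ℙ.+ (shift q (Δ δ) n ℙ.+ (shift (q * q) δ n ℙ.+ shift (q * q + q) δ n))
    ≡⟨ cancel (δ n) (shift q (Δ δ) n) (shift (q * q) δ n) (shift (q * q + q) δ n) _ ⟩
  δ n ℙ.+ shift (q * q + q + 1) δ n ∎
  where
  open ≡-Reasoning
  g = geometric q p

  second : mulF q (shift (q * q) (const 1ℙ)) n ≡
           shift (q * q) δ n ℙ.+ (shift (q * q + q) δ n ℙ.+ shift (q * q + q + 1) δ n)
  second = begin
    mulF q (shift (q * q) (const 1ℙ)) n
      ≡⟨ mulF-shift q (q * q) (const 1ℙ) n ⟩
    shift (q * q) (mulF q (const 1ℙ)) n
      ≡⟨ shift-cong (q * q) (mulF-1 q) n ⟩
    shift (q * q) (δ ⊞ shift q (Δ δ)) n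
      ≡⟨ shift-⊞ (q * q) δ (shift q (Δ δ)) n ⟩
    shift (q * q) δ n ℙ.+ shift (q * q) (shift q (Δ δ)) n
      ≡⟨ cong (shift (q * q) δ n ℙ.+_) (shift-shift (q * q) q (Δ δ) n) ⟩
    shift (q * q) δ n ℙ.+ shift (q * q + q) (δ ⊞ shift 1 δ) n
      ≡⟨ cong (shift (q * q) δ n ℙ.+_) (trans (shift-⊞ (q * q + q) δ (shift 1 δ) n)
           (cong (shift (q * q + q) δ n ℙ.+_) (shift-shift (q * q + q) 1 δ n))) ⟩
    shift (q * q) δ n ℙ.+ (shift (q * q + q) δ n ℙ.+ shift (q * q + q + 1) δ n) ∎

  third : mulF q (shift q g) n ≡
          shift q (Δ δ) n ℙ.+ (shift (q * q) δ n ℙ.+ shift (q * q + q) δ n)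
  third = begin
    mulF q (shift q g) n
      ≡⟨ mulF-shift q q g n ⟩
    shift q (mulF q g) n
      ≡⟨ shift-cong q (mulF≗Δ∘mulT q g) n ⟩
    shift q (Δ (mulT q g)) n
      ≡⟨ shift-cong q (⊞-cong (mulT-geometric q p) (shift-cong 1 (mulT-geometric q p))) n ⟩
    shift q (Δ (δ ⊞ shift (p * q) (pascal p))) n
      ≡⟨ shift-cong q (Δ-⊞ δ (shift (p * q) (pascal p))) n ⟩
    shift q (Δ δ ⊞ Δ (shift (p * q) (pascal p))) n
      ≡⟨ shift-⊞ q (Δ δ) (Δ (shift (p * q) (pascal p))) n ⟩
    shift q (Δ δ) n ℙ.+ shift q (Δ (shift (p * q) (pascal p))) n
      -- As `q` is `suc p`, `Δ (pascal p)` is `pascal q` and `q + p * q` is `q * q`, both by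
      -- definition.
      ≡⟨ cong (shift q (Δ δ) n ℙ.+_) (shift-cong q (Δ-shift (p * q) (pascal p)) n) ⟩
    shift q (Δ δ) n ℙ.+ shift q (shift (p * q) (pascal q)) n
      ≡⟨ cong (shift q (Δ δ) n ℙ.+_) (shift-shift q (p * q) (pascal q) n) ⟩
    shift q (Δ δ) n ℙ.+ shift (q * q) (pascal q) n
      ≡⟨ cong (shift q (Δ δ) n ℙ.+_) (shift-cong (q * q) frobenius n) ⟩
    shift q (Δ δ) n ℙ.+ shift (q * q) (δ ⊞ shift q δ) n
      ≡⟨ cong (shift q (Δ δ) n ℙ.+_) (trans (shift-⊞ (q * q) δ (shift q δ) n)
           (cong (shift (q * q) δ n ℙ.+_) (shift-shift (q * q) q δ n))) ⟩
    shift q (Δ δ) n ℙ.+ (shift (q * q) δ n ℙ.+ shift (q * q + q) δ n) ∎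

  cancel : ∀ a b c d e → (a ℙ.+ b) ℙ.+ (c ℙ.+ (d ℙ.+ e)) ℙ.+ (b ℙ.+ (c ℙ.+ d)) ≡ a ℙ.+ e
  cancel = solve-∀ 𝔽₂

-- From `q²` on, the two all-ones tails cancel, and the last summand has ended at
-- `q + (q - 1) q = q²`.
hSeq-vanishes : ∀ q .{{_ : NonZero q}} → Vanishes (q * q) (hSeq q)
hSeq-vanishes q@(suc p) {n} l = cong₂ ℙ._+_
  (cong (1ℙ ℙ.+_) (begin
    shift (q * q) (const 1ℙ) n                      ≡⟨ cong (shift (q * q) (const 1ℙ)) (ℕ.m+[n∸m]≡n l) ⟨
    shift (q * q) (const 1ℙ) (q * q + (n ∸ q * q))  ≡⟨ shift-+ (q * q) (const 1ℙ) (n ∸ q * q) ⟩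
    1ℙ                                              ∎))
  (shift-vanishes q (geometric-vanishes q p (ℕ.n≤1+n p)) l)
  where open ≡-Reasoning

-- Below `q²` the second summand is still zero, so `h` is the complement of the third.
#-hSeq : ∀ q .{{_ : NonZero q}} → # (q * q) (hSeq q) + pascalOnes q (pred q) ≡ q * q
#-hSeq q@(suc p) = begin
  # (q * q) (hSeq q) + pascalOnes q p
    ≡⟨ cong₂ _+_
         (#-cong (q * q) λ {i} l → cong (λ j → 1ℙ ℙ.+ j ℙ.+ s i) (shift-< (const 1ℙ) l))
         (trans (sym (#-geometric q p (ℕ.n≤1+n p)))
           (trans (cong (_+ # (p * q) (geometric q p)) (sym (#-0 q)))
             (sym (#-⊞-shift q (p * q) (geometric q p) λ _ → refl)))) ⟩
  # (q * q) (const 1ℙ ⊞ s) + # (q * q) s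
    ≡⟨ #-complement (q * q) s ⟩
  q * q ∎
  where
  open ≡-Reasoning
  s = shift q (geometric q p)

-- Periods of 1 / f and orders

Period : ℕ → Seq → Set
Period E u = ∀ n → u (E + n) ≡ u n

period-* : ∀ k {E u} → Period E u → Period (k * E) u
period-* zero    per n = refl
period-* (suc k) {E} {u} per n = trans (cong u (ℕ.+-assoc E (k * E) n))
  (trans (per (k * E + n)) (period-* k per n))

period-% : ∀ {N u} .{{_ : NonZero N}} → Period N u → ∀ n → u n ≡ u (n % N)
period-% {N} {u} per n = begin
  u n                        ≡⟨ cong u (m≡m%n+[m/n]*n n N) ⟩
  u (n % N + (n / N) * N)    ≡⟨ cong u (ℕ.+-comm (n % N) _) ⟩
  u ((n / N) * N + n % N)    ≡⟨ period-* (n / N) per (n % N) ⟩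
  u (n % N)                  ∎
  where open ≡-Reasoning

-- The known period `N` reduces the test to the finitely many `n < N`.
period? : ∀ {N u} .{{_ : NonZero N}} → Period N u → Decidable (λ E → Period E u)
period? {N} {u} per E = map′ to (λ p {n} _ → p n) (ℕ.allUpTo? (λ n → u (E + n) ℙ.≟ u n) N)
  where
  open ≡-Reasoning
  to : (∀ {n} → n < N → u (E + n) ≡ u n) → Period E u
  to p n = begin
    u (E + n)                        ≡⟨ cong (λ i → u (E + i)) (m≡m%n+[m/n]*n n N) ⟩
    u (E + (n % N + (n / N) * N))    ≡⟨ cong u (rearrange E (n % N) ((n / N) * N)) ⟩
    u ((n / N) * N + (E + n % N))    ≡⟨ period-* (n / N) per (E + n % N) ⟩
    u (E + n % N)                    ≡⟨ p (m%n<n n N) ⟩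
    u (n % N)                        ≡⟨ period-% per n ⟨
    u n                              ∎
    where
    rearrange : ∀ a b c → a + (b + c) ≡ c + (a + b)
    rearrange = solveℕ-∀

least : ∀ {P : ℕ → Set} → Decidable P → ∀ N → P N → ∃[ D ] P D × (∀ E → P E → D ≤ E)
least {P} P? = <-rec _ λ N ih PN → case ℕ.anyUpTo? P? N of λ where
  (yes (E , E<N , PE)) → ih E<N PE
  (no none)            → N , PN , λ E PE → ℕ.≮⇒≥ λ E<N → none (E , E<N , PE)

IsLeastPeriod : ℕ → Seq → Set
IsLeastPeriod D u = 1 ≤ D × Period D u × (∀ E → 1 ≤ E → Period E u → D ≤ E)

leastPeriod : ∀ {N u} .{{_ : NonZero N}} → Period N u → ∃[ D ] IsLeastPeriod D u
leastPeriod {suc M} {u} per with least (period? per ∘ suc) M per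
-- Candidates are searched in the form `suc E`, which excludes the trivial period 0.
... | D , perD , min = suc D , z<s , perD , λ { (suc E) _ perE → s≤s (min E perE) }

-- The remainder `N % D` is again a period and is less than `D`, so minimality forces it to be 0.
leastPeriod-∣ : ∀ {D N u} → IsLeastPeriod D u → Period N u → D ∣ℕ N
leastPeriod-∣ {D} {N} {u} (D≥1 , perD , min) perN = go (N % D) refl
  where
  instance _ = >-nonZero D≥1
  open ≡-Reasoning
  rem : Period (N % D) u
  rem n = begin
    u (N % D + n)                    ≡⟨ period-* (N / D) perD (N % D + n) ⟨
    u ((N / D) * D + (N % D + n))    ≡⟨ cong u (rearrange ((N / D) * D) (N % D) n) ⟩
    u (N % D + (N / D) * D + n)      ≡⟨ cong (λ i → u (i + n)) (m≡m%n+[m/n]*n N D) ⟨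
    u (N + n)                        ≡⟨ perN n ⟩
    u n                              ∎
    where
    rearrange : ∀ a b c → a + (b + c) ≡ b + a + c
    rearrange = solveℕ-∀
  go : ∀ i → N % D ≡ i → D ∣ℕ N
  go zero    e = divides (N / D) (trans (m≡m%n+[m/n]*n N D) (cong (_+ (N / D) * D) e))
  go (suc i) e = contradiction (min (N % D) (subst (1 ≤_) (sym e) z<s) rem) (ℕ.<⇒≱ (m%n<n N D))

#-period : ∀ k D {u} → Period D u → # (k * D) u ≡ k * # D u
#-period zero    D per = refl
#-period (suc k) D {u} per = trans (#-+ D (k * D) u)
  (cong (# D u +_) (trans (#-cong (k * D) λ {i} _ → per i) (#-period k D per)))

-- Quotients of `1 + x^E` by `f` as prefixes of `1 / f`

coeff-applyUpTo-period : ∀ E {u} → Period E u → coeff (applyUpTo u E) ≗ u ⊞ shift E u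
coeff-applyUpTo-period E {u} per n with n ℕ.<? E
... | yes n<E = trans (coeff-applyUpTo-< u n<E)
  (sym (trans (cong (u n ℙ.+_) (shift-< u n<E)) (ℙ.+-identityʳ (u n))))
... | no n≮E = trans
  (coeff-≥ (applyUpTo u E) (subst (_≤ n) (sym (length-applyUpTo u E)) E≤n))
  (sym (trans (cong₂ ℙ._+_ (trans (cong u split) (per _)) (trans (cong (shift E u) split) (shift-+ E u _)))
    (ℙ.p+p≡0ℙ (u (n ∸ E)))))
  where
  E≤n = ℕ.≮⇒≥ n≮E
  split : n ≡ E + (n ∸ E)
  split = sym (ℕ.m+[n∸m]≡n E≤n)

coeff-1+x^ : ∀ E → coeff (x^ 0 ⊕ x^ E) ≗ δ ⊞ shift E δ
coeff-1+x^ E n = trans (coeff-⊕ (x^ 0) (x^ E) n) (cong₂ ℙ._+_ (coeff-x^ 0 n) (coeff-x^ E n))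

mulF-⊞-shift : ∀ q u E → mulF q u ≗ δ → mulF q (u ⊞ shift E u) ≗ δ ⊞ shift E δ
mulF-⊞-shift q u E inv n = trans (mulF-⊞ q u (shift E u) n)
  (cong₂ ℙ._+_ (inv n) (trans (mulF-shift q E u n) (shift-cong E inv n)))

-- By periodicity the first `E` entries of `u` form the polynomial `(1 + x^E) u`, and `f u = 1`.
-- Taking `E = N₂ r` gives `h`; taking `E = D` gives `f*`.
period⇒quotient : ∀ r {u} → mulF (2 ^ r) u ≗ δ → ∀ {E} → Period E u →
                  IsQuotient (applyUpTo u E) (x^ 0 ⊕ x^ E) (f₂ r)
period⇒quotient r {u} inv {E} per n = begin
  coeff (applyUpTo u E ⊗ f₂ r) n             ≡⟨ coeff-⊗-f₂ r (applyUpTo u E) n ⟩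
  mulF (2 ^ r) (coeff (applyUpTo u E)) n     ≡⟨ mulF-cong (2 ^ r) (coeff-applyUpTo-period E per) n ⟩
  mulF (2 ^ r) (u ⊞ shift E u) n             ≡⟨ mulF-⊞-shift (2 ^ r) u E inv n ⟩
  δ n ℙ.+ shift E δ n                        ≡⟨ coeff-1+x^ E n ⟨
  coeff (x^ 0 ⊕ x^ E) n                      ∎
  where open ≡-Reasoning

-- A quotient g equals (1 + x^E) u, so u has period E beyond the length of g;
-- the known period N carries this back to all of u.
divides⇒period : ∀ r {u} → mulF (2 ^ r) u ≗ δ → ∀ {N} .{{_ : NonZero N}} → Period N u →
                 ∀ {E} → f₂ r ∣ x^ 0 ⊕ x^ E → Period E u
divides⇒period r {u} inv {N} perN {E} record { quotient = g ; equality = g⊗f≈ } n = begin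
  u (E + n)                  ≡⟨ period-* L perN (E + n) ⟨
  u (L * N + (E + n))        ≡⟨ cong u (rearrange (L * N) E n) ⟩
  u (E + (L * N + n))        ≡⟨ ℙ.+-cancelʳ-≡ (u (L * N + n)) _ _ (trans zeros (sym (ℙ.p+p≡0ℙ (u (L * N + n))))) ⟩
  u (L * N + n)              ≡⟨ period-* L perN n ⟩
  u n                        ∎
  where
  open ≡-Reasoning
  instance _ = ℕ.m^n≢0 2 r
  L = length g
  g≗ : coeff g ≗ u ⊞ shift E u
  g≗ = mulF-injective (2 ^ r) λ i → begin
    mulF (2 ^ r) (coeff g) i           ≡⟨ coeff-⊗-f₂ r g i ⟨
    coeff (g ⊗ f₂ r) i                 ≡⟨ g⊗f≈ i ⟩
    coeff (x^ 0 ⊕ x^ E) i              ≡⟨ coeff-1+x^ E i ⟩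
    δ i ℙ.+ shift E δ i                ≡⟨ mulF-⊞-shift (2 ^ r) u E inv i ⟨
    mulF (2 ^ r) (u ⊞ shift E u) i     ∎
  m = E + (L * N + n)
  L≤m : L ≤ m
  L≤m = ℕ.≤-trans (ℕ.≤-trans (ℕ.m≤m*n L N) (ℕ.m≤m+n (L * N) n)) (ℕ.m≤n+m (L * N + n) E)
  zeros : u m ℙ.+ u (L * N + n) ≡ 0ℙ
  zeros = begin
    u m ℙ.+ u (L * N + n)     ≡⟨ cong (u m ℙ.+_) (shift-+ E u (L * N + n)) ⟨
    u m ℙ.+ shift E u m       ≡⟨ g≗ m ⟨
    coeff g m                 ≡⟨ coeff-≥ g L≤m ⟩
    0ℙ                        ∎
  rearrange : ∀ a b c → a + (b + c) ≡ b + (a + c)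
  rearrange = solveℕ-∀

-- The periodic extension of h

periodize : ∀ N .{{_ : NonZero N}} → Seq → Seq
periodize N a n = a (n % N)

-- The functional equation of `a / (1 + x^N)`.
periodize-≗ : ∀ N .{{_ : NonZero N}} {a} → Vanishes N a → periodize N a ≗ a ⊞ shift N (periodize N a)
periodize-≗ N {a} v n with n ℕ.<? N
... | yes n<N = trans (cong a (m<n⇒m%n≡m n<N))
  (sym (trans (cong (a n ℙ.+_) (shift-< (periodize N a) n<N)) (ℙ.+-identityʳ (a n))))
... | no n≮N = begin
  a (n % N)                                     ≡⟨ cong (λ i → a (i % N)) split ⟩
  a ((n ∸ N + N) % N)                           ≡⟨ cong a ([m+n]%n≡m%n (n ∸ N) N) ⟩
  a ((n ∸ N) % N)                               ≡⟨ shift-+ N (periodize N a) (n ∸ N) ⟨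
  shift N (periodize N a) (N + (n ∸ N))         ≡⟨ cong (shift N (periodize N a)) (trans (ℕ.+-comm N (n ∸ N)) (sym split)) ⟩
  shift N (periodize N a) n                     ≡⟨ cong (ℙ._+ shift N (periodize N a) n) (v N≤n) ⟨
  a n ℙ.+ shift N (periodize N a) n             ∎
  where
  open ≡-Reasoning
  N≤n = ℕ.≮⇒≥ n≮N
  split : n ≡ n ∸ N + N
  split = sym (ℕ.m∸n+n≡m N≤n)

-- The product `w` of `f` and the extension satisfies `w = 1 + x^N + x^N w`; since `N > 0`, strong
-- induction yields `w = 1`.
mulF-periodize : ∀ q N .{{_ : NonZero N}} {a} → Vanishes N a → mulF q a ≗ δ ⊞ shift N δ →
                 mulF q (periodize N a) ≗ δ
mulF-periodize q N {a} v e = ≗-<-rec λ n ih → begin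
  mulF q u n                                   ≡⟨ mulF-cong q (periodize-≗ N v) n ⟩
  mulF q (a ⊞ shift N u) n                     ≡⟨ mulF-⊞ q a (shift N u) n ⟩
  mulF q a n ℙ.+ mulF q (shift N u) n          ≡⟨ cong₂ ℙ._+_ (e n) (mulF-shift q N u n) ⟩
  δ n ℙ.+ shift N δ n ℙ.+ shift N (mulF q u) n ≡⟨ cong (δ n ℙ.+ shift N δ n ℙ.+_) (shift-local N n ih) ⟩
  δ n ℙ.+ shift N δ n ℙ.+ shift N δ n          ≡⟨ cancel (δ n) (shift N δ n) ⟩
  δ n                                          ∎
  where
  open ≡-Reasoning
  u = periodize N a
  cancel : ∀ a b → a ℙ.+ b ℙ.+ b ≡ a
  cancel = solve-∀ 𝔽₂

4^r≡2^r*2^r : ∀ r → 4 ^ r ≡ 2 ^ r * 2 ^ r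
4^r≡2^r*2^r r = begin
  (2 ^ 2) ^ r          ≡⟨ ℕ.^-*-assoc 2 2 r ⟩
  2 ^ (r + (r + 0))    ≡⟨ cong (λ i → 2 ^ (r + i)) (ℕ.+-identityʳ r) ⟩
  2 ^ (r + r)          ≡⟨ ℕ.^-distribˡ-+-* 2 r r ⟩
  2 ^ r * 2 ^ r        ∎
  where open ≡-Reasoning

N₂≢0 : ∀ r → NonZero (N₂ r)
N₂≢0 r = >-nonZero (ℕ.m≤n+m 1 (4 ^ r + 2 ^ r))

-- The series `1 / f`, with the only facts about it that the order and robustness arguments use.
record PeriodicInverse (r : ℕ) : Set where
  field
    u        : Seq
    inverse  : mulF (2 ^ r) u ≗ δ
    periodic : Period (N₂ r) u
    ones     : # (N₂ r) u ≡ c₂ r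

periodicInverse : ∀ r → PeriodicInverse r
periodicInverse r = record
  { u        = periodize N h
  ; inverse  = mulF-periodize q N N-vanishes λ n →
      trans (mulF-hSeq q (pascal-frobenius r 0) n) (cong (λ i → δ n ℙ.+ shift (i + q + 1) δ n) (sym (4^r≡2^r*2^r r)))
  ; periodic = λ n → cong h (trans (cong (_% N) (ℕ.+-comm N n)) ([m+n]%n≡m%n n N))
  ; ones     = begin
      # N (periodize N h)             ≡⟨ #-cong N (λ l → cong h (m<n⇒m%n≡m l)) ⟩
      # N h                           ≡⟨ cong (λ i → # i h) (ℕ.+-assoc (4 ^ r) q 1) ⟩
      # (4 ^ r + (q + 1)) h           ≡⟨ #-widen (4 ^ r) (q + 1) vanishes ⟩
      # (4 ^ r) h                     ≡⟨ ℕ.m+n∸n≡m (# (4 ^ r) h) (3 ^ r) ⟨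
      # (4 ^ r) h + 3 ^ r ∸ 3 ^ r     ≡⟨ cong (_∸ 3 ^ r) total ⟩
      4 ^ r + q ∸ 3 ^ r               ≡⟨ ℕ.+-∸-comm q (ℕ.^-monoˡ-≤ r (ℕ.n≤1+n 3)) ⟩
      c₂ r                            ∎
  }
  where
  open ≡-Reasoning
  q = 2 ^ r
  N = N₂ r
  h = hSeq q
  instance
    _ = ℕ.m^n≢0 2 r
    _ = N₂≢0 r
  vanishes : Vanishes (4 ^ r) h
  vanishes = subst (λ i → Vanishes i h) (sym (4^r≡2^r*2^r r)) (hSeq-vanishes q)
  N-vanishes : Vanishes N h
  N-vanishes l = vanishes (ℕ.m+n≤o⇒m≤o (4 ^ r) (ℕ.m+n≤o⇒m≤o (4 ^ r + q) l))
  total : # (4 ^ r) h + 3 ^ r ≡ 4 ^ r + q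
  total = begin
    # (4 ^ r) h + 3 ^ r                            ≡⟨ cong₂ (λ i j → # i h + j) (4^r≡2^r*2^r r) (sym (pascalOnes-pred r)) ⟩
    # (q * q) h + (pascalOnes q (pred q) + q)      ≡⟨ ℕ.+-assoc (# (q * q) h) _ q ⟨
    # (q * q) h + pascalOnes q (pred q) + q        ≡⟨ cong (_+ q) (#-hSeq q) ⟩
    q * q + q                                      ≡⟨ cong (_+ q) (4^r≡2^r*2^r r) ⟨
    4 ^ r + q                                      ∎

-- Robustness

c₂+3^r : ∀ r → c₂ r + 3 ^ r ≡ 4 ^ r + 2 ^ r
c₂+3^r r = begin
  4 ^ r ∸ 3 ^ r + 2 ^ r + 3 ^ r      ≡⟨ swap (4 ^ r ∸ 3 ^ r) (2 ^ r) (3 ^ r) ⟩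
  4 ^ r ∸ 3 ^ r + 3 ^ r + 2 ^ r      ≡⟨ cong (_+ 2 ^ r) (ℕ.m∸n+n≡m (ℕ.^-monoˡ-≤ r (ℕ.n≤1+n 3))) ⟩
  4 ^ r + 2 ^ r                      ∎
  where
  open ≡-Reasoning
  swap : ∀ a b c → a + b + c ≡ a + c + b
  swap = solveℕ-∀

c₂+d₂ : ∀ r → c₂ r + d₂ r ≡ N₂ r
c₂+d₂ r = trans (sym (ℕ.+-assoc (c₂ r) (3 ^ r) 1)) (cong (_+ 1) (c₂+3^r r))

-- After adding `3 ^ r` to both sides the claim is `3 * 3 ^ r + 2 < 4 ^ r + 2 ^ r`. It holds from
-- `r = 4` on because `3^5 = 243 ≤ 256 = 4^4`, and fails at `r = 3`.
2d₂<c₂ : ∀ s → d₂ (4 + s) + d₂ (4 + s) < c₂ (4 + s)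
2d₂<c₂ s = ℕ.+-cancelʳ-< (3 ^ r) _ _ (begin-strict
  d₂ r + d₂ r + 3 ^ r              ≡⟨ expand (3 ^ s) ⟩
  243 * 3 ^ s + 2                  ≤⟨ ℕ.+-monoˡ-≤ 2 (ℕ.*-mono-≤ {243} {256} (ℕ.m≤m+n 243 13) (ℕ.^-monoˡ-≤ s (ℕ.n≤1+n 3))) ⟩
  256 * 4 ^ s + 2                  <⟨ ℕ.+-monoʳ-< (256 * 4 ^ s) (ℕ.^-monoʳ-< 2 (s<s z<s) {1} {r} (s<s z<s)) ⟩
  256 * 4 ^ s + 2 ^ r              ≡⟨ cong (_+ 2 ^ r) (ℕ.^-distribˡ-+-* 4 4 s) ⟨
  4 ^ r + 2 ^ r                    ≡⟨ c₂+3^r r ⟨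
  c₂ r + 3 ^ r                     ∎)
  where
  open ℕ.≤-Reasoning
  r = 4 + s
  expand : ∀ t → 3 * (3 * (3 * (3 * t))) + 1 + (3 * (3 * (3 * (3 * t))) + 1) + 3 * (3 * (3 * (3 * t))) ≡ 243 * t + 2
  expand = solveℕ-∀

-- If a ≤ b + 1, then c₂ ≤ d₂ + k ≤ 2 d₂, which leaves only r = 3;
-- there c₂ = 45 and d₂ = 28 are coprime.
common-factor-robust : ∀ r → 3 ≤ r → ∀ k {a b} → k * a ≡ c₂ r → k * b ≡ d₂ r → b + 1 < a
common-factor-robust r 3≤r k {a} {b} ka≡c kb≡d = ℕ.≰⇒> λ a≤b+1 → absurd r 3≤r ka≡c kb≡d (bound a≤b+1)
  where
  open ℕ.≤-Reasoning
  bound : a ≤ b + 1 → c₂ r ≤ d₂ r + k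
  bound a≤b+1 = begin
    c₂ r           ≡⟨ ka≡c ⟨
    k * a          ≤⟨ ℕ.*-monoʳ-≤ k a≤b+1 ⟩
    k * (b + 1)    ≡⟨ ℕ.*-distribˡ-+ k b 1 ⟩
    k * b + k * 1  ≡⟨ cong₂ _+_ kb≡d (ℕ.*-identityʳ k) ⟩
    d₂ r + k       ∎
  absurd : ∀ r → 3 ≤ r → k * a ≡ c₂ r → k * b ≡ d₂ r → ¬ c₂ r ≤ d₂ r + k
  absurd 1 (s≤s ()) _ _ _
  absurd 2 (s≤s (s≤s ())) _ _ _
  -- Here `45 ≤ 28 + k` gives `17 ≤ k`, against `k ∣ 1`.
  absurd 3 _ ka≡c kb≡d c≤d+k = ℕ.<⇒≱ (s<s (s≤s z≤n))
    (ℕ.≤-trans (ℕ.+-cancelˡ-≤ 28 17 k c≤d+k) (∣⇒≤ k∣1))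
    where
    k∣28 : k ∣ℕ 28
    k∣28 = subst (k ∣ℕ_) kb≡d (m∣m*n b)
    k∣45 : k ∣ℕ 45
    k∣45 = subst (k ∣ℕ_) ka≡c (m∣m*n a)
    k∣1 : k ∣ℕ 1
    k∣1 = subst (k ∣ℕ_) {gcd 28 45} refl (gcd-greatest k∣28 k∣45)
  absurd (suc (suc (suc (suc s)))) _ _ kb≡d c≤d+k = ℕ.<⇒≱ (2d₂<c₂ s)
    (ℕ.≤-trans c≤d+k (ℕ.+-monoʳ-≤ (d₂ (4 + s)) (∣⇒≤ {{>-nonZero (ℕ.m≤n+m 1 _)}} (subst (k ∣ℕ_) kb≡d (m∣m*n b)))))

-- The order, beta value and robustness of `f`

coeff-f₂-0 : ∀ r → coeff (f₂ r) 0 ≡ 1ℙ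
coeff-f₂-0 r with 2 ^ r | ℕ.m^n>0 2 r
... | suc p | _ = refl

-- `2 ^ r ≥ 2` keeps the term `x` from being cancelled by `x^(2^r)`; it then witnesses that `f` has
-- positive degree.
coeff-f₂-1 : ∀ r → 1 ≤ r → coeff (f₂ r) 1 ≡ 1ℙ
coeff-f₂-1 r 1≤r with 2 ^ r | ℕ.^-monoʳ-≤ 2 1≤r
... | suc (suc p) | _ = refl
... | suc zero    | s≤s ()

module _ (r : ℕ) (3≤r : 3 ≤ r) where
  open PeriodicInverse (periodicInverse r)

  private instance
    N₂-nonZero : NonZero (N₂ r)
    N₂-nonZero = N₂≢0 r

  leastPeriod⇒order : ∀ {D} → IsLeastPeriod D u → IsOrder (f₂ r) D
  leastPeriod⇒order {D} (D≥1 , perD , min) = record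
    { constant = coeff-f₂-0 r
    ; deg≥1    = coeff≡1⇒≤deg (f₂ r) (coeff-f₂-1 r (ℕ.≤-trans (ℕ.m≤m+n 1 2) 3≤r))
    ; D≥1      = D≥1
    ; divides  = record { quotient = applyUpTo u D ; equality = period⇒quotient r inverse perD }
    ; least    = λ E E≥1 f∣ → min E E≥1 (divides⇒period r inverse periodic f∣)
    }

  order : ∃[ D ] IsOrder (f₂ r) D × D ∣ℕ N₂ r
  order with leastPeriod periodic
  ... | D , isLeast = D , leastPeriod⇒order isLeast , leastPeriod-∣ isLeast periodic

  ℓ₀-h : ℓ₀ (N₂ r ∸ 1) (applyUpTo u (N₂ r)) ≡ d₂ r
  ℓ₀-h = ℕ.+-cancelˡ-≡ (c₂ r) _ _ (begin
    c₂ r + ℓ₀ (N₂ r ∸ 1) (applyUpTo u (N₂ r))          ≡⟨ cong (_+ ℓ₀ (N₂ r ∸ 1) (applyUpTo u (N₂ r))) ones ⟨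
    # (N₂ r) u + ℓ₀ (N₂ r ∸ 1) (applyUpTo u (N₂ r))    ≡⟨ ℓ₁+ℓ₀ u (N₂ r) ⟩
    N₂ r                                               ≡⟨ c₂+d₂ r ⟨
    c₂ r + d₂ r                                        ∎)
    where open ≡-Reasoning

  beta : IsBeta (N₂ r) (f₂ r) (c₂ r , d₂ r)
  beta with order
  ... | D , isOrder , D∣N =
    D , applyUpTo u (N₂ r) , isOrder , ℕ.m≤n+m 1 (4 ^ r + 2 ^ r) , D∣N ,
    period⇒quotient r inverse periodic , cong₂ _,_ ones ℓ₀-h

  robust : Robust (f₂ r)
  robust with leastPeriod periodic
  ... | D , isLeast@(D≥1 , perD , _) with leastPeriod-∣ isLeast periodic
  ...   | divides k N≡k*D =
    D , applyUpTo u D , leastPeriod⇒order isLeast , period⇒quotient r inverse perD ,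
    common-factor-robust r 3≤r k k*ℓ₁ k*ℓ₀
    where
    open ≡-Reasoning
    instance _ = >-nonZero D≥1
    zeros = ℓ₀ (D ∸ 1) (applyUpTo u D)
    k*ℓ₁ : k * # D u ≡ c₂ r
    k*ℓ₁ = begin
      k * # D u      ≡⟨ #-period k D perD ⟨
      # (k * D) u    ≡⟨ cong (λ i → # i u) N≡k*D ⟨
      # (N₂ r) u     ≡⟨ ones ⟩
      c₂ r           ∎
    -- Only ones are counted over the `k` periods; the zeros follow by subtraction from
    -- `N₂ r = k * D`.
    k*ℓ₀ : k * zeros ≡ d₂ r
    k*ℓ₀ = ℕ.+-cancelˡ-≡ (c₂ r) _ _ (begin
      c₂ r + k * zeros           ≡⟨ cong (_+ k * zeros) k*ℓ₁ ⟨
      k * # D u + k * zeros      ≡⟨ ℕ.*-distribˡ-+ k (# D u) zeros ⟨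
      k * (# D u + zeros)        ≡⟨ cong (k *_) (ℓ₁+ℓ₀ u D) ⟩
      k * D                      ≡⟨ N≡k*D ⟨
      N₂ r                       ≡⟨ c₂+d₂ r ⟨
      c₂ r + d₂ r                ∎)

theorem2p10 : ∀ (r : ℕ) → 3 ≤ r →
    (∃[ D ] IsOrder (f₂ r) D × D ∣ℕ N₂ r) ×
    (∃[ h ] IsQuotient h (x^ 0 ⊕ x^ (N₂ r)) (f₂ r) × ℓ₁ h ≡ c₂ r) ×
    (IsBeta (N₂ r) (f₂ r) (c₂ r , d₂ r) × Robust (f₂ r))
theorem2p10 r 3≤r =
  order r 3≤r ,
  (applyUpTo u (N₂ r) , period⇒quotient r inverse periodic , ones) ,
  (beta r 3≤r , robust r 3≤r)
  where open PeriodicInverse (periodicInverse r)
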